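{- The competitive ratio of every Move-To-Front-Every-Other-Access algorithm (for any choice of initial bits) is exactly $2.5$ (full cost model): $2.5$ is the infimum of the constants $c$ for which there exists $b$ with $A(\sigma)\le c\cdot\mathrm{OPT}(\sigma)+b$ for all request sequences $\sigma$.
   Context: Static list update: a list of $l$ distinct items in some initial order; serving a request to the item at position $i$ (from the front) costs $i$ (full cost model); the accessed item may be moved closer to the front for free (free exchange); two adjacent items may be swapped at cost $1$ (paid exchange). $A(\sigma)$ is the total cost of algorithm $A$ and $\mathrm{OPT}(\sigma)$ the minimum cost of any offline algorithm from the same initial list. The constant $b$ may depend on the list length but not on $\sigma$. A Move-To-Front-Every-Other-Access (MTF2) algorithm maintains one bit per item, with arbitrary initial values; on each request to an item $z$ it flips the bit of $z$, and if the bit becomes $0$ it moves $z$ to the front (free exchange), otherwise it leaves the list unchanged; it makes no paid exchanges. -}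

module Defs where

open import Data.Bool using (Bool; not; if_then_else_)
open import Data.Fin using (Fin; zero; suc)
open import Data.Fin.Properties using (_≟_; any?)
open import Data.Integer using (+_)
open import Data.List using (List; []; _∷_)
open import Data.Nat using (ℕ; zero; suc; pred; _+_; _∸_; _≤_; _<_; z≤n; s≤s; _≤?_)
open import Data.Nat.Properties
  using (≤-refl; ≤-trans; ≤-reflexive; ≤-antisym; +-comm; +-monoʳ-≤; m+[n∸m]≡n;
         m+n≤o⇒m≤o; m+n≤o⇒m≤o∸n; anyUpTo?)
open import Data.Product using (∃; ∃-syntax; Σ-syntax; _×_; _,_; proj₁)
open import Data.Rational as ℚ using (ℚ)
open import Data.Sum using (_⊎_; inj₁; inj₂)
open import Data.Vec using (Vec; []; _∷_; lookup; updateAt)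
open import Data.Vec.Relation.Unary.Unique.Propositional using (Unique)
open import Relation.Binary.PropositionalEquality using (_≡_)
open import Relation.Nullary using (Dec; yes; no; contradiction; does)
open import Relation.Nullary.Decidable using (map′; _×-dec_; _⊎-dec_)
open import Relation.Unary using (Decidable)

private
  variable
    l n : ℕ

Item : ℕ → Set
Item l = Fin l

-- The front of the list is the head of the vector.  That a list of length l
-- holds each of the l items once is a hypothesis (Unique) on the initial list.
Arrangement : ℕ → Set
Arrangement l = Vec (Item l) l

preceding : Item l → Vec (Item l) n → ℕ
preceding z []       = 0
preceding z (x ∷ xs) = if does (z ≟ x) then 0 else suc (preceding z xs)

position : Item l → Vec (Item l) n → ℕ
position z xs = suc (preceding z xs)

stepForward : Item l → Vec (Item l) n → Vec (Item l) n
stepForward z []           = []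
stepForward z (x ∷ [])     = x ∷ []
stepForward z (x ∷ y ∷ xs) =
  if does (z ≟ y) then y ∷ x ∷ xs else x ∷ stepForward z (y ∷ xs)

advance : ℕ → Item l → Vec (Item l) n → Vec (Item l) n
advance zero    z xs = xs
advance (suc k) z xs = advance k z (stepForward z xs)

moveToFront : Item l → Vec (Item l) n → Vec (Item l) n
moveToFront z xs = advance (preceding z xs) z xs

swapAdjacent : ∀ {n} → Fin (pred n) → Vec (Item l) n → Vec (Item l) n
swapAdjacent {n = suc (suc n)} zero    (x ∷ y ∷ xs) = y ∷ x ∷ xs
swapAdjacent {n = suc (suc n)} (suc i) (x ∷ xs)     = x ∷ swapAdjacent i xs

-- Every way of serving a request sequence from a given list.  The free exchange
-- brings the accessed item k places closer to the front, and k < position z L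
-- covers every possible destination, including staying in place.
data Schedule {l : ℕ} : Arrangement l → List (Item l) → Set where
  done  : ∀ {L} → Schedule L []
  paid  : ∀ {L σ} (i : Fin (pred l)) →
          Schedule (swapAdjacent i L) σ → Schedule L σ
  serve : ∀ {L z σ} (k : ℕ) → k < position z L →
          Schedule (advance k z L) σ → Schedule L (z ∷ σ)

cost : {L : Arrangement l} {σ : List (Item l)} → Schedule L σ → ℕ
cost done                          = 0
cost (paid i S)                    = suc (cost S)
cost (serve {L = L} {z = z} k _ S) = position z L + cost S

IsMinimumCost : Arrangement l → List (Item l) → ℕ → Set
IsMinimumCost L σ m =
  (Σ[ S ∈ Schedule L σ ] cost S ≡ m) × (∀ (S : Schedule L σ) → m ≤ cost S)

private
  Within : Arrangement l → List (Item l) → ℕ → Set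
  Within L σ k = Σ[ S ∈ Schedule L σ ] cost S ≤ k

  idle : ∀ (L : Arrangement l) σ → Schedule L σ
  idle L []      = done
  idle L (z ∷ σ) = serve 0 (s≤s z≤n) (idle L σ)

  module _ {l} {σ : List (Item l)} (z : Item l)
           (rest? : ∀ L k → Dec (Within L σ k)) where

    Served Swapped : Arrangement l → ℕ → Set
    Served L k = position z L ≤ k ×
      (∃[ j ] (j < position z L × Within (advance j z L) σ (k ∸ position z L)))
    Swapped L k =
      ∃[ i ] Σ[ S ∈ Schedule (swapAdjacent i L) (z ∷ σ) ] suc (cost S) ≤ k

    to : ∀ {L k} → Served L k ⊎ Swapped L k → Within L (z ∷ σ) k
    to {L} (inj₁ (p≤k , j , j<p , S , q)) = serve j j<p S ,
      ≤-trans (+-monoʳ-≤ (position z L) q) (≤-reflexive (m+[n∸m]≡n p≤k))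
    to (inj₂ (i , S , q)) = paid i S , q

    from : ∀ {L k} → Within L (z ∷ σ) k → Served L k ⊎ Swapped L k
    from (paid i S , q) = inj₂ (i , S , q)
    from {L} (serve j j<p S , q) = inj₁
      (m+n≤o⇒m≤o (position z L) q , j , j<p , S , m+n≤o⇒m≤o∸n (cost S)
        (≤-trans (≤-reflexive (+-comm (cost S) (position z L))) q))

    served? : ∀ L k → Dec (Served L k)
    served? L k = (position z L ≤? k) ×-dec
      anyUpTo? (λ j → rest? (advance j z L) (k ∸ position z L)) (position z L)

    withinCons? : ∀ L k → Dec (Within L (z ∷ σ) k)
    swapped?    : ∀ L k → Dec (Swapped L k)

    withinCons? L k = map′ to from (served? L k ⊎-dec swapped? L k)

    swapped? L zero    = no λ { (_ , _ , ()) }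
    swapped? L (suc k) = map′
      (λ { (i , S , p) → i , S , s≤s p })
      (λ { (i , S , s≤s p) → i , S , p })
      (any? λ i → withinCons? (swapAdjacent i L) k)

  within? : ∀ (L : Arrangement l) σ k → Dec (Within L σ k)
  within? L []      k = yes (done , z≤n)
  within? L (z ∷ σ) k = withinCons? z (λ L′ → within? L′ σ) L k

  least : ∀ {P : ℕ → Set} → Decidable P → ∀ k → P k →
          ∃[ m ] (P m × (∀ j → P j → m ≤ j))
  least P? zero    p = 0 , p , λ _ _ → z≤n
  least {P} P? (suc k) p with P? 0
  ... | yes p₀ = 0 , p₀ , λ _ _ → z≤n
  ... | no ¬p₀ with least (λ j → P? (suc j)) k p
  ...   | m , pm , m≤ = suc m , pm , bound
    where
    bound : ∀ j → P j → suc m ≤ j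
    bound zero    q = contradiction q ¬p₀
    bound (suc j) q = s≤s (m≤ j q)

minimumCost : ∀ (L : Arrangement l) σ → ∃ (IsMinimumCost L σ)
minimumCost L σ with least (within? L σ) (cost (idle L σ)) (idle L σ , ≤-refl)
... | m , (S , S≤m) , m≤ =
  m , (S , ≤-antisym S≤m (m≤ _ (S , ≤-refl))) , λ T → m≤ _ (T , ≤-refl)

OPT : Arrangement l → List (Item l) → ℕ
OPT L σ = proj₁ (minimumCost L σ)

-- The bit 1 is true.
Bits : ℕ → Set
Bits l = Vec Bool l

MTF2-cost : Bits l → Arrangement l → List (Item l) → ℕ
MTF2-cost bits L []      = 0
MTF2-cost bits L (z ∷ σ) = position z L + MTF2-cost bits′ L′ σ
  where
  bits′ = updateAt bits z not
  L′    = if lookup bits′ z then L else moveToFront z L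

-- A Move-To-Front-Every-Other-Access algorithm is determined by its initial
-- bits, which may depend on the list it is started on.
InitialBits : Set
InitialBits = ∀ {l} → Arrangement l → Bits l

fromℕ : ℕ → ℚ
fromℕ n = + n ℚ./ 1

-- One constant c serves lists of all lengths, whereas b may depend on the length.
Competitive : InitialBits → ℚ → Set
Competitive init c =
  ∀ l → ∃[ b ] (∀ (L : Arrangement l) → Unique L → ∀ (σ : List (Item l)) →
    fromℕ (MTF2-cost (init L) L σ) ℚ.≤ c ℚ.* fromℕ (OPT L σ) ℚ.+ b)

IsInfimum : (ℚ → Set) → ℚ → Set
IsInfimum P m =
  (∀ c → P c → m ℚ.≤ c) × (∀ d → (∀ c → P c → d ℚ.≤ c) → d ℚ.≤ m)

CompetitiveRatio : InitialBits → ℚ → Set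
CompetitiveRatio init r = IsInfimum (Competitive init) r

{-# OPTIONS --safe #-}

-- Upper bound.  Compare MTF2 with an arbitrary schedule by a potential that is a
-- sum over pairs of items: the later item y of the schedule's list contributes
-- half its bit, and a pair that MTF2 holds in the opposite order contributes in
-- addition 2 or 1, the number of requests to its trailing item after which MTF2
-- repairs it.  For every pair, MTF2's cost plus the change of potential is at
-- most 5/2 times the schedule's cost.
--
-- Lower bound.  Let both lists be w₁ … wₙ and all bits 1.  Request w₁, …, wₙ once
-- each, then w₁, …, wₙ three times each.  The first sweep costs n (n + 1) / 2 to
-- both sides and reverses MTF2's list, so that in the second sweep every item is
-- requested twice in MTF2's last place; OPT moves each item to the front on the
-- first of its three requests.  Both lists are then reversed and all bits are 1
-- again.  A round costs MTF2 n (5n + 3) / 2 and OPT at most n (n + 3).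
module Submission where

open import Defs
open import Data.Bool as Bool using (Bool; true; false; not; if_then_else_)
import Data.Bool.Properties as Boolₚ
open import Data.Fin using (zero; suc)
open import Data.Fin.Properties using (_≟_; injective⇒≤)
open import Data.Integer as ℤ using (+_)
import Data.Integer.Properties as ℤₚ
open import Data.Integer.Tactic.RingSolver using () renaming (solve-∀ to solveℤ-∀)
open import Data.List using (List; []; _∷_; _++_; _ʳ++_; length; map; reverse)
open import Data.List.Membership.Propositional using (_∈_)
open import Data.List.Properties
  using (++-assoc; ++-identityʳ; length-++; length-reverse; unfold-reverse; ʳ++-defn; ∷-injective)
open import Data.List.Relation.Binary.Permutation.Propositional as Perm
  using (_↭_; ↭-refl; ↭-sym; ↭-trans)
open import Data.List.Relation.Binary.Permutation.Propositional.Properties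
  using (All-resp-↭; ∈-resp-↭; map⁺; shift; ↭-reverse)
import Data.List.Relation.Binary.Permutation.Setoid.Properties as PermS
open import Data.List.Relation.Unary.All as All using (All; []; _∷_)
import Data.List.Relation.Unary.All.Properties as Allₚ
open import Data.List.Relation.Unary.AllPairs using ([]; _∷_)
open import Data.List.Relation.Unary.Any using (here; there)
open import Data.List.Relation.Unary.Unique.Propositional using (Unique)
open import Data.Nat hiding (_≟_; _/_)
open import Data.Nat.ListAction using (sum)
open import Data.Nat.ListAction.Properties using (sum-↭)
open import Data.Nat.Properties renaming (_≟_ to _≟ℕ_)
open import Data.Nat.Tactic.RingSolver using (solve-∀)
open import Data.Product using (_×_; _,_; proj₁; proj₂; ∃; ∃₂)
open import Data.Rational as ℚ using (mkℚ; _/_; ↥_; ↧ₙ_; toℚᵘ)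
import Data.Rational.Properties as ℚₚ
open import Data.Rational.Unnormalised as ℚᵘ using (mkℚᵘ; *≤*; *≡*)
import Data.Rational.Unnormalised.Properties as ℚᵘₚ
open import Data.Sum as Sum using (_⊎_; inj₁; inj₂)
open import Data.Vec as Vec using (Vec; []; _∷_; lookup; updateAt; toList)
open import Data.Vec.Membership.Propositional.Properties using (∈-toList⁺; ∈-lookup)
open import Data.Vec.Properties using (lookup∘updateAt; lookup∘updateAt′; length-toList)
import Data.Vec.Relation.Unary.All.Properties as VecAll
open import Data.Vec.Relation.Unary.AllPairs using ([]; _∷_)
open import Data.Vec.Relation.Unary.Any using (any?)
open import Data.Vec.Relation.Unary.Unique.Propositional using () renaming (Unique to VecUnique)
open import Data.Vec.Relation.Unary.Unique.Propositional.Properties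
  using (lookup-injective; tabulate⁺)
open import Function using (_∘_; id)
open import Relation.Binary.PropositionalEquality
open import Relation.Nullary using (Dec; yes; no; does; ¬_; contradiction)
open import Relation.Nullary.Decidable
  using (dec-true; dec-false; from-yes; map′; _×-dec_; _→-dec_)
open import Relation.Unary using (Decidable)

private
  variable
    l n : ℕ

-- Sums over lists and over ordered pairs of entries.

module _ {a} {A : Set a} where

  ∑ : List A → (A → ℕ) → ℕ
  ∑ K f = sum (map f K)

  ∑-mono : ∀ K {f g : A → ℕ} → (∀ x → f x ≤ g x) → ∑ K f ≤ ∑ K g
  ∑-mono []      f≤g = z≤n
  ∑-mono (x ∷ K) f≤g = +-mono-≤ (f≤g x) (∑-mono K f≤g)

  ∑-cong : ∀ K {f g : A → ℕ} → (∀ x → f x ≡ g x) → ∑ K f ≡ ∑ K g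
  ∑-cong []      f≡g = refl
  ∑-cong (x ∷ K) f≡g = cong₂ _+_ (f≡g x) (∑-cong K f≡g)

  ∑-+ : ∀ K (f g : A → ℕ) → ∑ K (λ x → f x + g x) ≡ ∑ K f + ∑ K g
  ∑-+ []      f g = refl
  ∑-+ (x ∷ K) f g rewrite ∑-+ K f g = lemma (f x) (g x) (∑ K f) (∑ K g)
    where
    lemma : ∀ a b c d → a + b + (c + d) ≡ a + c + (b + d)
    lemma = solve-∀

  ∑-*ˡ : ∀ K c (f : A → ℕ) → ∑ K (λ x → c * f x) ≡ c * ∑ K f
  ∑-*ˡ []      c f = sym (*-zeroʳ c)
  ∑-*ˡ (x ∷ K) c f rewrite ∑-*ˡ K c f = sym (*-distribˡ-+ c (f x) (∑ K f))

  ∑-*ʳ : ∀ K c (f : A → ℕ) → ∑ K (λ x → f x * c) ≡ ∑ K f * c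
  ∑-*ʳ []      c f = refl
  ∑-*ʳ (x ∷ K) c f rewrite ∑-*ʳ K c f = sym (*-distribʳ-+ c (f x) (∑ K f))

  ∑-↭ : ∀ {J K} (f : A → ℕ) → J ↭ K → ∑ J f ≡ ∑ K f
  ∑-↭ f J↭K = sum-↭ (map⁺ f J↭K)

  ∑-const : ∀ K c → ∑ K (λ _ → c) ≡ length K * c
  ∑-const []      c = refl
  ∑-const (x ∷ K) c = cong (λ s → c + s) (∑-const K c)

  ∑² : List A → (A → A → ℕ) → ℕ
  ∑² K f = ∑ K λ x → ∑ K (f x)

  ∑²-mono : ∀ K {f g : A → A → ℕ} → (∀ x y → f x y ≤ g x y) → ∑² K f ≤ ∑² K g
  ∑²-mono K f≤g = ∑-mono K λ x → ∑-mono K (f≤g x)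

  -- With `f = δ z` this writes `g` along row and column `z` of the matrix of pairs, doubled at the
  -- diagonal entry and 0 elsewhere. In this form the cost of a request to `z` is charged to pairs.
  symmetrised : (A → ℕ) → (A → ℕ) → A → A → ℕ
  symmetrised f g x y = f x * g y + g x * f y

  -- Every product `f x * g y` is counted at `(x , y)` and again at `(y , x)`, whence the factor 2.
  -- The extra summand `h` carries the pair potentials along.
  ∑²-symmetrised-+ : ∀ K c f g (h : A → A → ℕ) →
    ∑² K (λ x y → c * symmetrised f g x y + h x y) ≡ 2 * c * (∑ K f * ∑ K g) + ∑² K h
  ∑²-symmetrised-+ K c f g h = begin
    ∑² K (λ x y → c * symmetrised f g x y + h x y)
      ≡⟨ ∑-cong K (λ x → begin
           ∑ K (λ y → c * symmetrised f g x y + h x y)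
             ≡⟨ ∑-+ K _ _ ⟩
           ∑ K (λ y → c * symmetrised f g x y) + ∑ K (h x)
             ≡⟨ cong (_+ ∑ K (h x)) (∑-*ˡ K c _) ⟩
           c * ∑ K (symmetrised f g x) + ∑ K (h x)
             ≡⟨ cong (λ s → c * s + ∑ K (h x)) (∑-+ K _ _) ⟩
           c * (∑ K (λ y → f x * g y) + ∑ K (λ y → g x * f y)) + ∑ K (h x)
             ≡⟨ cong₂ (λ s t → c * (s + t) + ∑ K (h x)) (∑-*ˡ K (f x) g) (∑-*ˡ K (g x) f) ⟩
           c * (f x * ∑ K g + g x * ∑ K f) + ∑ K (h x) ∎) ⟩
    ∑ K (λ x → c * (f x * ∑ K g + g x * ∑ K f) + ∑ K (h x))
      ≡⟨ ∑-+ K _ _ ⟩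
    ∑ K (λ x → c * (f x * ∑ K g + g x * ∑ K f)) + ∑² K h
      ≡⟨ cong (_+ ∑² K h) (∑-*ˡ K c _) ⟩
    c * ∑ K (λ x → f x * ∑ K g + g x * ∑ K f) + ∑² K h
      ≡⟨ cong (λ s → c * s + ∑² K h) (∑-+ K _ _) ⟩
    c * (∑ K (λ x → f x * ∑ K g) + ∑ K (λ x → g x * ∑ K f)) + ∑² K h
      ≡⟨ cong₂ (λ s t → c * (s + t) + ∑² K h) (∑-*ʳ K (∑ K g) f) (∑-*ʳ K (∑ K f) g) ⟩
    c * (∑ K f * ∑ K g + ∑ K g * ∑ K f) + ∑² K h
      ≡⟨ lemma c (∑ K f) (∑ K g) (∑² K h) ⟩
    2 * c * (∑ K f * ∑ K g) + ∑² K h ∎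
    where
    open ≡-Reasoning
    lemma : ∀ c s t u → c * (s * t + t * s) + u ≡ 2 * c * (s * t) + u
    lemma = solve-∀

Unique-resp-↭ : ∀ {a} {A : Set a} {J K : List A} → J ↭ K → Unique J → Unique K
Unique-resp-↭ J↭K = PermS.Unique-resp-↭ (setoid _) (Perm.↭⇒↭ₛ J↭K)

-- Indicators and the relative order of two items.

bit : Bool → ℕ
bit b = if b then 1 else 0

δ : Item l → Item l → ℕ
δ z x = bit (does (z ≟ x))

δ-refl : ∀ (z : Item l) → δ z z ≡ 1
δ-refl z = cong bit (dec-true (z ≟ z) refl)

δ-≢ : ∀ {z x : Item l} → z ≢ x → δ z x ≡ 0
δ-≢ {z = z} {x} z≢x = cong bit (dec-false (z ≟ x) z≢x)

∑-δ-fresh : ∀ {z : Item l} {K} → All (z ≢_) K → ∑ K (δ z) ≡ 0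
∑-δ-fresh []              = refl
∑-δ-fresh (z≢x ∷ z∉K) = cong₂ _+_ (δ-≢ z≢x) (∑-δ-fresh z∉K)

∑-δ : ∀ {z : Item l} {K} → Unique K → z ∈ K → ∑ K (δ z) ≡ 1
∑-δ {z = z} (z∉K ∷ K!) (here refl) = cong₂ _+_ (δ-refl z) (∑-δ-fresh z∉K)
∑-δ {z = z} {x ∷ K} (x∉K ∷ K!) (there z∈K) =
  cong₂ _+_ (δ-≢ {z = z} λ { refl → All.lookup x∉K z∈K refl }) (∑-δ K! z∈K)

-- Reflexive: an item precedes itself.
precedes : Item l → Item l → Vec (Item l) n → Bool
precedes x y []       = true
precedes x y (w ∷ ws) =
  if does (x ≟ w) then true else if does (y ≟ w) then false else precedes x y ws

precedes-refl : ∀ (x : Item l) (ws : Vec (Item l) n) → precedes x x ws ≡ true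
precedes-refl x []       = refl
precedes-refl x (w ∷ ws) with x ≟ w
... | yes _ = refl
... | no  _ = precedes-refl x ws

-- Membership keeps the search from reaching the empty list, where both orders default to `true`.
precedes-antisym : ∀ {x y : Item l} (ws : Vec (Item l) n) → x ≢ y → x ∈ toList ws →
                   precedes y x ws ≡ not (precedes x y ws)
precedes-antisym {x = x} {y} (w ∷ ws) x≢y x∈ with x ≟ w | y ≟ w | x∈
... | yes refl | yes refl | _         = contradiction refl x≢y
... | yes _    | no _     | _         = refl
... | no _     | yes _    | _         = refl
... | no x≢w   | no _     | here x≡w  = contradiction x≡w x≢w
... | no _     | no _     | there x∈′ = precedes-antisym ws x≢y x∈′

-- Full access cost is one unit per item ahead of `z` and one for `z` itself; the last unit is the
-- reflexive term of `precedes`. This distributes access costs over pairs.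
∑-precedes : ∀ {z : Item l} (ws : Vec (Item l) n) → Unique (toList ws) → z ∈ toList ws →
             ∑ (toList ws) (λ x → bit (precedes x z ws)) ≡ position z ws
∑-precedes {z = z} (w ∷ ws) (w∉ws ∷ ws!) z∈ with w ≟ w | z ≟ w | z∈
... | no w≢w | _ | _ = contradiction refl w≢w
... | yes _ | yes refl | _ = cong suc (none w∉ws)
  where
  none : ∀ {K} → All (z ≢_) K → ∑ K (λ x → bit (if does (x ≟ z) then true else false)) ≡ 0
  none [] = refl
  none {x ∷ K} (z≢x ∷ z∉K) rewrite dec-false (x ≟ z) (z≢x ∘ sym) = none z∉K
... | yes _ | no z≢w | here z≡w = contradiction z≡w z≢w
... | yes _ | no z≢w | there z∈′ = cong suc (trans (tail w∉ws) (∑-precedes ws ws! z∈′))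
  where
  tail : ∀ {K} → All (w ≢_) K →
         ∑ K (λ x → bit (if does (x ≟ w) then true else precedes x z ws)) ≡
         ∑ K (λ x → bit (precedes x z ws))
  tail [] = refl
  tail {x ∷ K} (w≢x ∷ w∉K) rewrite dec-false (x ≟ w) (w≢x ∘ sym) = cong (λ s → _ + s) (tail w∉K)

-- Lists under free and paid exchanges.

-- Pair potentials see a list only through `precedes`, so this one interface covers both the
-- schedule's free exchange and the two reactions of MTF2, moving `z` or staying.
record Promotes (z : Item l) (ws ws′ : Vec (Item l) n) : Set where
  field
    others  : ∀ {x y} → x ≢ z → y ≢ z → precedes x y ws′ ≡ precedes x y ws
    forward : ∀ {y} → precedes z y ws Bool.≤ precedes z y ws′
    permute : toList ws′ ↭ toList ws

open Promotes

Promotes-refl : ∀ (z : Item l) (ws : Vec (Item l) n) → Promotes z ws ws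
Promotes-refl z ws = record
  { others = λ _ _ → refl ; forward = Boolₚ.≤-refl ; permute = ↭-refl }

Promotes-trans : ∀ {z : Item l} {us vs ws : Vec (Item l) n} →
                 Promotes z us vs → Promotes z vs ws → Promotes z us ws
Promotes-trans p q = record
  { others  = λ x≢z y≢z → trans (others q x≢z y≢z) (others p x≢z y≢z)
  ; forward = λ {y} → Boolₚ.≤-trans (forward p {y}) (forward q)
  ; permute = ↭-trans (permute q) (permute p)
  }

Promotes-∷ : ∀ {z : Item l} w {ws ws′ : Vec (Item l) n} →
             Promotes z ws ws′ → Promotes z (w ∷ ws) (w ∷ ws′)
Promotes-∷ {z = z} w {ws} {ws′} p = record
  { others  = λ {x} {y} x≢z y≢z →
      cong (λ b → if does (x ≟ w) then true else if does (y ≟ w) then false else b)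
           (others p x≢z y≢z)
  ; forward = λ {y} → forward′ y
  ; permute = Perm.prep w (permute p)
  }
  where
  forward′ : ∀ y → precedes z y (w ∷ ws) Bool.≤ precedes z y (w ∷ ws′)
  forward′ y with z ≟ w | y ≟ w
  ... | yes _ | _     = Boolₚ.≤-refl
  ... | no  _ | yes _ = Boolₚ.≤-refl
  ... | no  _ | no _  = forward p

Promotes-swap : ∀ (z w : Item l) (ws : Vec (Item l) n) →
                Promotes z (w ∷ z ∷ ws) (z ∷ w ∷ ws)
Promotes-swap z w ws = record
  { others = others′ ; forward = λ {y} → forward′ y ; permute = Perm.swap z w ↭-refl }
  where
  others′ : ∀ {x y} → x ≢ z → y ≢ z →
            precedes x y (z ∷ w ∷ ws) ≡ precedes x y (w ∷ z ∷ ws)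
  others′ {x} {y} x≢z y≢z rewrite dec-false (x ≟ z) x≢z | dec-false (y ≟ z) y≢z = refl
  forward′ : ∀ y → precedes z y (w ∷ z ∷ ws) Bool.≤ precedes z y (z ∷ w ∷ ws)
  forward′ y rewrite dec-true (z ≟ z) refl = Boolₚ.≤-maximum _

stepForward-promotes : ∀ (z : Item l) (ws : Vec (Item l) n) → Promotes z ws (stepForward z ws)
stepForward-promotes z []           = Promotes-refl z []
stepForward-promotes z (x ∷ [])     = Promotes-refl z (x ∷ [])
stepForward-promotes z (x ∷ y ∷ ws) with z ≟ y | stepForward-promotes z (y ∷ ws)
... | yes refl | _ = Promotes-swap z x ws
... | no  _    | p = Promotes-∷ x p

advance-promotes : ∀ k (z : Item l) (ws : Vec (Item l) n) → Promotes z ws (advance k z ws)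
advance-promotes zero    z ws = Promotes-refl z ws
advance-promotes (suc k) z ws =
  Promotes-trans (stepForward-promotes z ws) (advance-promotes k z (stepForward z ws))

-- Splits off the last step instead of the first: in an induction on the list, the head is the last
-- item that `z` passes.
advance-suc : ∀ k (z : Item l) (ws : Vec (Item l) n) →
              advance (suc k) z ws ≡ stepForward z (advance k z ws)
advance-suc zero    z ws = refl
advance-suc (suc k) z ws = advance-suc k z (stepForward z ws)

-- An inductive witness for `preceding z ws ≡ k`. It stores the inequalities that decide the tests
-- of `stepForward`, and each step lowers its index by one.
data Located (z : Item l) : ℕ → Vec (Item l) n → Set where
  here  : ∀ {ws : Vec (Item l) n} → Located z 0 (z ∷ ws)
  there : ∀ {x k} {ws : Vec (Item l) n} → z ≢ x → Located z k ws → Located z (suc k) (x ∷ ws)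

locate : ∀ {z : Item l} (ws : Vec (Item l) n) → z ∈ toList ws → Located z (preceding z ws) ws
locate {z = z} (x ∷ ws) z∈ with z ≟ x | z∈
... | yes refl | _         = here
... | no z≢x   | here z≡x  = contradiction z≡x z≢x
... | no z≢x   | there z∈′ = there z≢x (locate ws z∈′)

Located-stepForward : ∀ {z : Item l} {k} {ws : Vec (Item l) n} →
                      Located z (suc k) ws → Located z k (stepForward z ws)
Located-stepForward {z = z} (there _ here) rewrite dec-true (z ≟ z) refl = here
Located-stepForward {z = z} (there z≢x (there {x = y} z≢y p)) rewrite dec-false (z ≟ y) z≢y =
  there z≢x (Located-stepForward (there z≢y p))

Located-advance : ∀ {z : Item l} {k} {ws : Vec (Item l) n} →
                  Located z k ws → Located z 0 (advance k z ws)
Located-advance {k = zero}  p = p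
Located-advance {k = suc k} p = Located-advance (Located-stepForward p)

precedes-head : ∀ {z : Item l} {ws : Vec (Item l) n} y → Located z 0 ws → precedes z y ws ≡ true
precedes-head {z = z} y here rewrite dec-true (z ≟ z) refl = refl

moveToFront-precedes : ∀ {z : Item l} (ws : Vec (Item l) n) y → z ∈ toList ws →
                       precedes z y (moveToFront z ws) ≡ true
moveToFront-precedes ws y z∈ = precedes-head y (Located-advance (locate ws z∈))

-- Says nothing about the new order of `u` and `v` themselves: whatever happens at that pair is
-- absorbed by the uniform bound on its potential.
record Transposes (u v : Item l) (ws ws′ : Vec (Item l) n) : Set where
  field
    others  : ∀ x y → (u ≡ x × v ≡ y) ⊎ (v ≡ x × u ≡ y) ⊎ precedes x y ws′ ≡ precedes x y ws
    permute : toList ws′ ↭ toList ws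

swapAdjacent-transposes : ∀ i (ws : Vec (Item l) n) →
                          ∃₂ λ u v → Transposes u v ws (swapAdjacent i ws)
swapAdjacent-transposes {n = suc (suc n)} zero (u ∷ v ∷ ws) = u , v , record
  { others = others′ ; permute = Perm.swap v u ↭-refl }
  where
  others′ : ∀ x y → (u ≡ x × v ≡ y) ⊎ (v ≡ x × u ≡ y) ⊎
            precedes x y (v ∷ u ∷ ws) ≡ precedes x y (u ∷ v ∷ ws)
  others′ x y with x ≟ u | x ≟ v | y ≟ u | y ≟ v
  ... | yes refl | _        | _        | yes refl = inj₁ (refl , refl)
  ... | _        | yes refl | yes refl | _        = inj₂ (inj₁ (refl , refl))
  ... | yes _    | yes _    | _        | _        = inj₂ (inj₂ refl)
  ... | yes _    | no _     | _        | no _     = inj₂ (inj₂ refl)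
  ... | no _     | yes _    | no _     | _        = inj₂ (inj₂ refl)
  ... | no _     | no _     | yes _    | yes _    = inj₂ (inj₂ refl)
  ... | no _     | no _     | yes _    | no _     = inj₂ (inj₂ refl)
  ... | no _     | no _     | no _     | yes _    = inj₂ (inj₂ refl)
  ... | no _     | no _     | no _     | no _     = inj₂ (inj₂ refl)
swapAdjacent-transposes {n = suc (suc n)} (suc i) (w ∷ ws)
  with u , v , t ← swapAdjacent-transposes i ws = u , v , record
  { others = λ x y → Sum.map₂ (Sum.map₂ (cong λ b →
      if does (x ≟ w) then true else if does (y ≟ w) then false else b))
      (Transposes.others t x y)
  ; permute = Perm.prep w (Transposes.permute t)
  }

-- The potential of a pair and of two lists.

-- Twice the potential of an unordered pair {u , v}, where a and o tell whether u
-- is ahead of v in the algorithm's and in the optimal list.  The item that is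
-- second in the optimal list contributes its bit; an inversion costs in addition
-- 4 or 2, twice the number of requests to the trailing item that repair it.
pairPotential : (a o bᵤ bᵥ : Bool) → ℕ
pairPotential a o bᵤ bᵥ =
  if o then bit bᵥ + (if a then 0 else repair bᵤ)
       else bit bᵤ + (if a then repair bᵥ else 0)
  where
  repair : Bool → ℕ
  repair b = if b then 2 else 4

allBool? : ∀ {p} {P : Bool → Set p} → Decidable P → Dec (∀ b → P b)
allBool? P? = map′ (λ { (t , f) true → t ; (t , f) false → f })
                   (λ h → h true , h false) (P? true ×-dec P? false)

-- Reading an unordered pair from its other end negates both orders and exchanges the bits. This
-- reduces column `z` to row `z` when ordered pairs are summed.
pairPotential-not : ∀ a o bᵤ bᵥ → pairPotential (not a) (not o) bᵥ bᵤ ≡ pairPotential a o bᵤ bᵥ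
pairPotential-not = from-yes
  (allBool? λ a → allBool? λ o → allBool? λ bᵤ → allBool? λ bᵥ →
    pairPotential (not a) (not o) bᵥ bᵤ ≟ℕ pairPotential a o bᵤ bᵥ)

pairPotential≤5 : ∀ a o bᵤ bᵥ → pairPotential a o bᵤ bᵥ ≤ 5
pairPotential≤5 = from-yes
  (allBool? λ a → allBool? λ o → allBool? λ bᵤ → allBool? λ bᵥ →
    pairPotential a o bᵤ bᵥ ≤? 5)

-- The ratio 5/2 arises here, with `u` requested. If `u` trails `v` only in MTF2's list, each of up
-- to two requests lowers the repair term by 2 and so pays for MTF2's access. If `u` trails in both
-- lists, MTF2 may move it while the schedule does not, which costs 2 and creates an inversion worth
-- 4 when `v` has bit 0; the schedule's 5 and the bit of `u` pay for these 6.
pairPotential-serve : ∀ a o o′ b bᵥ → o Bool.≤ o′ →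
  2 * bit (not a) + pairPotential (if not b then a else true) o′ (not b) bᵥ ≤
  5 * bit (not o) + pairPotential a o b bᵥ
pairPotential-serve = from-yes
  (allBool? λ a → allBool? λ o → allBool? λ o′ → allBool? λ b → allBool? λ bᵥ →
    (o Boolₚ.≤? o′) →-dec
    (2 * bit (not a) + pairPotential (if not b then a else true) o′ (not b) bᵥ ≤?
     5 * bit (not o) + pairPotential a o b bᵥ))

-- The enumeration `K` stays fixed while the lists change. Ordered pairs count each unordered pair
-- twice, and its potential is already doubled, so all costs appear with a factor 4. A diagonal
-- entry is just the bit of its item.
potential : List (Item l) → Bits l → Vec (Item l) n → Vec (Item l) n → ℕ
potential K bits LA LO = ∑² K λ u v →
  pairPotential (precedes u v LA) (precedes u v LO) (lookup bits u) (lookup bits v)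

symmetrised-δ-diag : ∀ (z : Item l) g → symmetrised (δ z) g z z ≡ 2 * g z
symmetrised-δ-diag z g rewrite δ-refl z = lemma (g z)
  where
  lemma : ∀ a → 1 * a + a * 1 ≡ 2 * a
  lemma = solve-∀

symmetrised-δˡ : ∀ {z y : Item l} g → z ≢ y → symmetrised (δ z) g z y ≡ g y
symmetrised-δˡ {z = z} {y} g z≢y rewrite δ-refl z | δ-≢ z≢y = lemma (g y) (g z)
  where
  lemma : ∀ a b → 1 * a + b * 0 ≡ a
  lemma = solve-∀

symmetrised-δʳ : ∀ {z x : Item l} g → z ≢ x → symmetrised (δ z) g x z ≡ g x
symmetrised-δʳ {z = z} {x} g z≢x rewrite δ-refl z | δ-≢ z≢x = *-identityʳ (g x)

symmetrised-δ-other : ∀ {z x y : Item l} g → z ≢ x → z ≢ y → symmetrised (δ z) g x y ≡ 0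
symmetrised-δ-other {z = z} {x} {y} g z≢x z≢y rewrite δ-≢ z≢x | δ-≢ z≢y = *-zeroʳ (g x)

-- Amortised cost of a request, of a paid exchange and of a schedule.

module _ {LA LA′ LO LO′ : Vec (Item l) n} {z : Item l} (bits : Bits l)
         (promA : Promotes z LA LA′) (promO : Promotes z LO LO′)
         (front : ∀ y → precedes z y LA′ ≡
                        (if not (lookup bits z) then precedes z y LA else true))
         (z∈LA : z ∈ toList LA) (z∈LO : z ∈ toList LO) where

  private
    bits′ : Bits l
    bits′ = updateAt bits z not

    pair pair′ : Item l → Item l → ℕ
    pair x y = pairPotential (precedes x y LA) (precedes x y LO) (lookup bits x) (lookup bits y)
    pair′ x y =
      pairPotential (precedes x y LA′) (precedes x y LO′) (lookup bits′ x) (lookup bits′ y)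

    upToA upToO : Item l → ℕ
    upToA x = bit (precedes x z LA)
    upToO x = bit (precedes x z LO)

    pair-sym : ∀ {x} → z ≢ x → pair x z ≡ pair z x
    pair-sym {x} z≢x
      rewrite precedes-antisym {y = x} LA z≢x z∈LA | precedes-antisym {y = x} LO z≢x z∈LO =
      pairPotential-not (precedes z x LA) (precedes z x LO) _ _

    pair′-sym : ∀ {x} → z ≢ x → pair′ x z ≡ pair′ z x
    pair′-sym {x} z≢x
      rewrite precedes-antisym {y = x} LA′ z≢x (∈-resp-↭ (↭-sym (permute promA)) z∈LA)
            | precedes-antisym {y = x} LO′ z≢x (∈-resp-↭ (↭-sym (permute promO)) z∈LO) =
      pairPotential-not (precedes z x LA′) (precedes z x LO′) _ _

    serve-requested : ∀ {y} → z ≢ y → 2 * upToA y + pair′ z y ≤ 5 * upToO y + pair z y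
    serve-requested {y} z≢y
      rewrite precedes-antisym {y = y} LA z≢y z∈LA | precedes-antisym {y = y} LO z≢y z∈LO
            | lookup∘updateAt z {not} bits | lookup∘updateAt′ y z {not} (z≢y ∘ sym) bits
            | front y =
      pairPotential-serve (precedes z y LA) (precedes z y LO) (precedes z y LO′)
        (lookup bits z) (lookup bits y) (forward promO)

    ServePair : Item l → Item l → Set
    ServePair x y = 2 * symmetrised (δ z) upToA x y + pair′ x y ≤
                    5 * symmetrised (δ z) upToO x y + pair x y

    -- The item's own unit of access cost is charged 4 to MTF2 and 10 to the schedule; the slack of
    -- 6 covers the new diagonal potential, which is at most 5.
    serve-diag : ServePair z z
    serve-diag = begin
      2 * symmetrised (δ z) upToA z z + pair′ z z
        ≡⟨ cong (λ s → 2 * s + pair′ z z) (symmetrised-δ-diag z upToA) ⟩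
      2 * (2 * upToA z) + pair′ z z
        ≡⟨ cong (λ b → 2 * (2 * bit b) + pair′ z z) (precedes-refl z LA) ⟩
      4 + pair′ z z
        ≤⟨ +-monoʳ-≤ 4 (pairPotential≤5 (precedes z z LA′) (precedes z z LO′) _ _) ⟩
      9
        ≤⟨ m≤m+n 9 (suc (pair z z)) ⟩
      9 + suc (pair z z)
        ≡⟨ +-suc 9 (pair z z) ⟩
      10 + pair z z
        ≡⟨ cong (λ b → 5 * (2 * bit b) + pair z z) (precedes-refl z LO) ⟨
      5 * (2 * upToO z) + pair z z
        ≡⟨ cong (λ s → 5 * s + pair z z) (symmetrised-δ-diag z upToO) ⟨
      5 * symmetrised (δ z) upToO z z + pair z z ∎
      where open ≤-Reasoning

    serve-rowˡ : ∀ {y} → z ≢ y → ServePair z y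
    serve-rowˡ {y} z≢y = subst₂ (λ s t → 2 * s + pair′ z y ≤ 5 * t + pair z y)
      (sym (symmetrised-δˡ upToA z≢y)) (sym (symmetrised-δˡ upToO z≢y)) (serve-requested z≢y)

    serve-rowʳ : ∀ {x} → z ≢ x → ServePair x z
    serve-rowʳ {x} z≢x = subst₂ _≤_
      (cong₂ (λ s t → 2 * s + t) (sym (symmetrised-δʳ upToA z≢x)) (sym (pair′-sym z≢x)))
      (cong₂ (λ s t → 5 * s + t) (sym (symmetrised-δʳ upToO z≢x)) (sym (pair-sym z≢x)))
      (serve-requested z≢x)

    serve-others : ∀ {x y} → z ≢ x → z ≢ y → ServePair x y
    serve-others {x} {y} z≢x z≢y
      rewrite symmetrised-δ-other upToA z≢x z≢y | symmetrised-δ-other upToO z≢x z≢y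
            | others promA (z≢x ∘ sym) (z≢y ∘ sym) | others promO (z≢x ∘ sym) (z≢y ∘ sym)
            | lookup∘updateAt′ x z {not} (z≢x ∘ sym) bits
            | lookup∘updateAt′ y z {not} (z≢y ∘ sym) bits = ≤-refl

    serve-pair : ∀ {x y} → Dec (z ≡ x) → Dec (z ≡ y) → ServePair x y
    serve-pair (yes refl) (yes refl) = serve-diag
    serve-pair (yes refl) (no z≢y)   = serve-rowˡ z≢y
    serve-pair (no z≢x)   (yes refl) = serve-rowʳ z≢x
    serve-pair (no z≢x)   (no z≢y)   = serve-others z≢x z≢y

  -- Sums the pairwise inequalities. Row and column `z` both carry the access cost, which turns 2
  -- and 5 into 4 and 10.
  serve-potential : ∀ {K} → Unique K → z ∈ K → toList LA ↭ K → toList LO ↭ K →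
    4 * position z LA + potential K bits′ LA′ LO′ ≤ 10 * position z LO + potential K bits LA LO
  serve-potential {K} K! z∈K LA↭K LO↭K = begin
    4 * position z LA + ∑² K pair′
      ≡⟨ cong (λ s → 4 * s + ∑² K pair′) (rank LA LA↭K) ⟨
    4 * (∑ K (δ z) * ∑ K upToA) + ∑² K pair′
      ≡⟨ ∑²-symmetrised-+ K 2 (δ z) upToA pair′ ⟨
    ∑² K (λ x y → 2 * symmetrised (δ z) upToA x y + pair′ x y)
      ≤⟨ ∑²-mono K (λ x y → serve-pair (z ≟ x) (z ≟ y)) ⟩
    ∑² K (λ x y → 5 * symmetrised (δ z) upToO x y + pair x y)
      ≡⟨ ∑²-symmetrised-+ K 5 (δ z) upToO pair ⟩
    10 * (∑ K (δ z) * ∑ K upToO) + ∑² K pair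
      ≡⟨ cong (λ s → 10 * s + ∑² K pair) (rank LO LO↭K) ⟩
    10 * position z LO + ∑² K pair ∎
    where
    open ≤-Reasoning
    rank : ∀ L → toList L ↭ K → ∑ K (δ z) * ∑ K (λ x → bit (precedes x z L)) ≡ position z L
    rank L L↭K = trans (cong (_* ∑ K _) (∑-δ K! z∈K)) (trans (*-identityˡ (∑ K _))
      (trans (∑-↭ _ (↭-sym L↭K))
        (∑-precedes L (Unique-resp-↭ (↭-sym L↭K) K!)
          (∈-resp-↭ (↭-sym L↭K) z∈K))))

-- Only the entries `(u , v)` and `(v , u)` can change, each by at most 5. Together this is the 10
-- that the schedule's unit cost provides.
swap-potential : ∀ {K} (bits : Bits l) (LA : Vec (Item l) n) {LO LO′ u v} →
  Unique K → u ∈ K → v ∈ K → Transposes u v LO LO′ →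
  potential K bits LA LO′ ≤ 10 + potential K bits LA LO
swap-potential {K = K} bits LA {LO} {LO′} {u} {v} K! u∈K v∈K t = begin
  ∑² K (pair LO′)
    ≤⟨ ∑²-mono K swap-pair ⟩
  ∑² K (λ x y → 5 * symmetrised (δ u) (δ v) x y + pair LO x y)
    ≡⟨ ∑²-symmetrised-+ K 5 (δ u) (δ v) (pair LO) ⟩
  10 * (∑ K (δ u) * ∑ K (δ v)) + ∑² K (pair LO)
    ≡⟨ cong₂ (λ s t → 10 * (s * t) + ∑² K (pair LO)) (∑-δ K! u∈K) (∑-δ K! v∈K) ⟩
  10 + ∑² K (pair LO) ∎
  where
  open ≤-Reasoning
  pair : Vec (Item _) _ → Item _ → Item _ → ℕ
  pair L x y = pairPotential (precedes x y LA) (precedes x y L) (lookup bits x) (lookup bits y)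

  swap-pair : ∀ x y → pair LO′ x y ≤ 5 * symmetrised (δ u) (δ v) x y + pair LO x y
  swap-pair x y with Transposes.others t x y
  ... | inj₁ (refl , refl) rewrite δ-refl u | δ-refl v =
    ≤-trans (pairPotential≤5 (precedes u v LA) (precedes u v LO′) _ _)
      (≤-trans (m≤m+n 5 _) (≤-trans (*-monoʳ-≤ 5 (m≤m+n 1 (δ v u * δ u v))) (m≤m+n _ _)))
  ... | inj₂ (inj₁ (refl , refl)) rewrite δ-refl u | δ-refl v =
    ≤-trans (pairPotential≤5 (precedes v u LA) (precedes v u LO′) _ _)
      (≤-trans (*-monoʳ-≤ 5 (m≤n+m 1 (δ u v * δ v u))) (m≤m+n _ _))
  ... | inj₂ (inj₂ same) rewrite same = m≤n+m _ _

-- Telescoping along the schedule; the final potential is dropped because it is nonnegative. The two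
-- lists vary independently, as they diverge during the induction.
amortised : ∀ {K : List (Item l)} → Unique K → (∀ z → z ∈ K) →
  ∀ bits {LA LO : Arrangement l} {σ} (S : Schedule LO σ) →
  toList LA ↭ K → toList LO ↭ K →
  4 * MTF2-cost bits LA σ ≤ 10 * cost S + potential K bits LA LO
amortised K! all∈K bits done LA↭K LO↭K = z≤n
amortised {K = K} K! all∈K bits {LA} {LO} {σ} (paid i S) LA↭K LO↭K
  with u , v , t ← swapAdjacent-transposes i LO = begin
  4 * MTF2-cost bits LA σ
    ≤⟨ amortised K! all∈K bits S LA↭K (↭-trans (Transposes.permute t) LO↭K) ⟩
  10 * cost S + potential K bits LA (swapAdjacent i LO)
    ≤⟨ +-monoʳ-≤ (10 * cost S) (swap-potential bits LA K! (all∈K u) (all∈K v) t) ⟩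
  10 * cost S + (10 + potential K bits LA LO)
    ≡⟨ lemma (cost S) (potential K bits LA LO) ⟩
  10 * suc (cost S) + potential K bits LA LO ∎
  where
  open ≤-Reasoning
  lemma : ∀ s p → 10 * s + (10 + p) ≡ 10 * suc s + p
  lemma = solve-∀
amortised {K = K} K! all∈K bits {LA} {LO} {z ∷ σ} (serve k _ S) LA↭K LO↭K = begin
  4 * (position z LA + MTF2-cost bits′ LA′ σ)
    ≡⟨ *-distribˡ-+ 4 (position z LA) _ ⟩
  4 * position z LA + 4 * MTF2-cost bits′ LA′ σ
    ≤⟨ +-monoʳ-≤ (4 * position z LA) (amortised K! all∈K bits′ S
         (↭-trans (permute promA) LA↭K) (↭-trans (permute promO) LO↭K)) ⟩
  4 * position z LA + (10 * cost S + potential K bits′ LA′ LO′)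
    ≡⟨ lemma (4 * position z LA) (10 * cost S) _ ⟩
  10 * cost S + (4 * position z LA + potential K bits′ LA′ LO′)
    ≤⟨ +-monoʳ-≤ (10 * cost S) (serve-potential bits promA promO front
         (∈-resp-↭ (↭-sym LA↭K) (all∈K z)) (∈-resp-↭ (↭-sym LO↭K) (all∈K z))
         K! (all∈K z) LA↭K LO↭K) ⟩
  10 * cost S + (10 * position z LO + potential K bits LA LO)
    ≡⟨ lemma′ (position z LO) (cost S) _ ⟩
  10 * (position z LO + cost S) + potential K bits LA LO ∎
  where
  open ≤-Reasoning
  bits′ = updateAt bits z not
  LA′   = if lookup bits′ z then LA else moveToFront z LA
  LO′   = advance k z LO
  promO = advance-promotes k z LO
  z∈LA  = ∈-resp-↭ (↭-sym LA↭K) (all∈K z)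

  promA : Promotes z LA LA′
  promA with lookup bits′ z
  ... | true  = Promotes-refl z LA
  ... | false = advance-promotes (preceding z LA) z LA

  front : ∀ y → precedes z y LA′ ≡ (if not (lookup bits z) then precedes z y LA else true)
  front y rewrite lookup∘updateAt z {not} bits with lookup bits z
  ... | true  = moveToFront-precedes LA y z∈LA
  ... | false = refl

  lemma : ∀ a b c → a + (b + c) ≡ b + (a + c)
  lemma = solve-∀
  lemma′ : ∀ p s q → 10 * s + (10 * p + q) ≡ 10 * (p + s) + q
  lemma′ = solve-∀

-- The upper bound for lists of distinct items.

Unique-toList : ∀ {L : Vec (Item l) n} → VecUnique L → Unique (toList L)
Unique-toList []         = []
Unique-toList (x∉L ∷ L!) = VecAll.toList⁺ x∉L ∷ Unique-toList L!

-- Pigeonhole: a missing `z` put in front would give `l + 1` distinct elements of `Fin l`.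
Unique-complete : ∀ {L : Arrangement l} → VecUnique L → ∀ z → z ∈ toList L
Unique-complete {L = L} L! z with any? (z ≟_) L
... | yes z∈L = ∈-toList⁺ z∈L
... | no  z∉L =
  contradiction (injective⇒≤ (λ {i} {j} → lookup-injective z∷L! i j)) 1+n≰n
  where
  z∷L! : VecUnique (z ∷ L)
  z∷L! = VecAll.lookup⁻ (λ { i refl → z∉L (∈-lookup i L) }) ∷ L!

potential≤ : ∀ (K : List (Item l)) bits (LA LO : Vec (Item l) n) →
             potential K bits LA LO ≤ length K * (length K * 5)
potential≤ K bits LA LO = begin
  potential K bits LA LO
    ≤⟨ ∑²-mono K (λ x y → pairPotential≤5 (precedes x y LA) (precedes x y LO) _ _) ⟩
  ∑² K (λ _ _ → 5)
    ≡⟨ ∑-cong K (λ _ → ∑-const K 5) ⟩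
  ∑ K (λ _ → length K * 5)
    ≡⟨ ∑-const K _ ⟩
  length K * (length K * 5) ∎
  where open ≤-Reasoning

-- The initial potential is bounded in terms of `l` alone, which makes the bound uniform in the
-- initial bits.
MTF2-upper : ∀ bits {L : Arrangement l} → VecUnique L → ∀ {σ} (S : Schedule L σ) →
             4 * MTF2-cost bits L σ ≤ 10 * cost S + l * (l * 5)
MTF2-upper bits {L} L! S =
  ≤-trans (amortised (Unique-toList L!) (Unique-complete L!) bits S ↭-refl ↭-refl)
    (+-monoʳ-≤ (10 * cost S)
      (subst (λ k → potential (toList L) bits L L ≤ k * (k * 5)) (length-toList L)
        (potential≤ (toList L) bits L L)))

-- Exact effect of moves on a list split at the requested item.

stepForward-∷ : ∀ {z : Item l} x {k} {ws : Vec (Item l) n} → Located z (suc k) ws →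
                stepForward z (x ∷ ws) ≡ x ∷ stepForward z ws
stepForward-∷ {z = z} x (there {x = y} z≢y p) rewrite dec-false (z ≟ y) z≢y = refl

advance-∷ : ∀ {z : Item l} x {k} {ws : Vec (Item l) n} → Located z k ws →
            advance k z (x ∷ ws) ≡ x ∷ advance k z ws
advance-∷ x {zero}  p = refl
advance-∷ {z = z} x {suc k} p =
  trans (cong (advance k z) (stepForward-∷ x p)) (advance-∷ x (Located-stepForward p))

Located-++ : ∀ {z : Item l} {p q} (ws : Vec (Item l) n) → All (z ≢_) p →
             toList ws ≡ p ++ z ∷ q → Located z (length p) ws
Located-++ {p = []}    (x ∷ ws) z∉p         refl = here
Located-++ {p = x ∷ p} (y ∷ ws) (z≢x ∷ z∉p) eq with refl , eq′ ← ∷-injective eq =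
  there z≢x (Located-++ ws z∉p eq′)

preceding-Located : ∀ {z : Item l} {k} {ws : Vec (Item l) n} → Located z k ws →
                    preceding z ws ≡ k
preceding-Located {z = z} here rewrite dec-true (z ≟ z) refl = refl
preceding-Located {z = z} (there {x = x} z≢x p) rewrite dec-false (z ≟ x) z≢x =
  cong suc (preceding-Located p)

preceding-++ : ∀ {z : Item l} {p q} (ws : Vec (Item l) n) → All (z ≢_) p →
               toList ws ≡ p ++ z ∷ q → preceding z ws ≡ length p
preceding-++ ws z∉p eq = preceding-Located (Located-++ ws z∉p eq)

-- By induction `z` first reaches the front of the tail, with the head untouched; one more step then
-- takes it past the head.
advance-++ : ∀ {z : Item l} {p q} (ws : Vec (Item l) n) → All (z ≢_) p →
             toList ws ≡ p ++ z ∷ q → toList (advance (length p) z ws) ≡ z ∷ p ++ q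
advance-++ {p = []} ws z∉p eq = eq
advance-++ {z = z} {x ∷ p} {q} (y ∷ ws) (z≢x ∷ z∉p) eq with refl , eq′ ← ∷-injective eq
  rewrite advance-suc (length p) z (x ∷ ws) | advance-∷ x (Located-++ ws z∉p eq′) =
  bubble (advance (length p) z ws) (advance-++ ws z∉p eq′)
  where
  bubble : ∀ vs → toList vs ≡ z ∷ p ++ q → toList (stepForward z (x ∷ vs)) ≡ z ∷ x ∷ p ++ q
  bubble (_ ∷ vs) eq with refl , eq′ ← ∷-injective eq
    rewrite dec-true (z ≟ z) refl = cong (λ ws → z ∷ x ∷ ws) eq′

moveToFront-++ : ∀ {z : Item l} {p q} (ws : Vec (Item l) n) → All (z ≢_) p →
                 toList ws ≡ p ++ z ∷ q → toList (moveToFront z ws) ≡ z ∷ p ++ q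
moveToFront-++ ws z∉p eq rewrite preceding-++ ws z∉p eq = advance-++ ws z∉p eq

-- Single requests and the costs they force.

flipBit : Item l → Bits l → Bits l
flipBit z bits = updateAt bits z not

MTF2-stay : ∀ (bits : Bits l) L {z} σ → lookup bits z ≡ false →
            MTF2-cost bits L (z ∷ σ) ≡ position z L + MTF2-cost (flipBit z bits) L σ
MTF2-stay bits L {z} σ b rewrite lookup∘updateAt z {not} bits | b = refl

MTF2-move : ∀ (bits : Bits l) L {z} σ → lookup bits z ≡ true →
            MTF2-cost bits L (z ∷ σ) ≡
            position z L + MTF2-cost (flipBit z bits) (moveToFront z L) σ
MTF2-move bits L {z} σ b rewrite lookup∘updateAt z {not} bits | b = refl

-- One request sequence that is expensive for MTF2 and cheap for some schedule. Sequences are built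
-- backwards: the lemmas that prepend requests take the evidence for the state reached afterwards as
-- a continuation.
record Forces (bits : Bits l) (LA LO : Arrangement l) (a o : ℕ) : Set where
  constructor forces
  field
    {requests} : List (Item l)
    schedule   : Schedule LO requests
    atLeast    : a ≤ MTF2-cost bits LA requests
    atMost     : cost schedule ≤ o

AllBits : Bool → Bits l → List (Item l) → Set
AllBits b bits = All λ x → lookup bits x ≡ b

AllBits-flip : ∀ {b} (bits : Bits l) {z ws} → All (z ≢_) ws →
               AllBits b bits ws → AllBits b (flipBit z bits) ws
AllBits-flip bits [] [] = []
AllBits-flip bits {z} {x ∷ _} (z≢x ∷ z∉ws) (b ∷ bs) =
  trans (lookup∘updateAt′ x z (z≢x ∘ sym) bits) b ∷ AllBits-flip bits z∉ws bs

lookup-flip : ∀ {b} (bits : Bits l) z → lookup bits z ≡ b → lookup (flipBit z bits) z ≡ not b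
lookup-flip bits z b = trans (lookup∘updateAt z bits) (cong not b)

module _ {bits : Bits l} {LA LO : Arrangement l} {z pA qA pO qO}
         (z∉pA : All (z ≢_) pA) (z∉pO : All (z ≢_) pO)
         (LA≡ : toList LA ≡ pA ++ z ∷ qA) (LO≡ : toList LO ≡ pO ++ z ∷ qO) where

  private
    k<position : ∀ {k} → k ≤ length pO → k < position z LO
    k<position k≤ rewrite preceding-++ LO z∉pO LO≡ = s≤s k≤

    position≡ : position z LO ≡ suc (length pO)
    position≡ = cong suc (preceding-++ LO z∉pO LO≡)

  request-stay : ∀ {a o} k → k ≤ length pO → lookup bits z ≡ false →
    Forces (flipBit z bits) LA (advance k z LO) a o →
    Forces bits LA LO (suc (length pA) + a) (suc (length pO) + o)
  request-stay k k≤ b (forces {σ} S a≤ ≤o) = forces (serve k (k<position k≤) S)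
    (≤-trans (+-mono-≤ (≤-reflexive (cong suc (sym (preceding-++ LA z∉pA LA≡)))) a≤)
             (≤-reflexive (sym (MTF2-stay bits LA σ b))))
    (+-mono-≤ (≤-reflexive position≡) ≤o)

  request-move : ∀ {a o} k → k ≤ length pO → lookup bits z ≡ true →
    Forces (flipBit z bits) (moveToFront z LA) (advance k z LO) a o →
    Forces bits LA LO (suc (length pA) + a) (suc (length pO) + o)
  request-move k k≤ b (forces {σ} S a≤ ≤o) = forces (serve k (k<position k≤) S)
    (≤-trans (+-mono-≤ (≤-reflexive (cong suc (sym (preceding-++ LA z∉pA LA≡)))) a≤)
             (≤-reflexive (sym (MTF2-move bits LA σ b))))
    (+-mono-≤ (≤-reflexive position≡) ≤o)

module _ {a p} {A : Set a} {P : A → Set p} where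

  All-reverse⁺ : ∀ {xs} → All P xs → All P (reverse xs)
  All-reverse⁺ {xs} = All-resp-↭ (↭-sym (↭-reverse xs))

  All-reverse⁻ : ∀ {xs} → All P (reverse xs) → All P xs
  All-reverse⁻ {xs} = All-resp-↭ (↭-reverse xs)

-- The two sweeps of a round.

-- The sum of `k + 1`, ..., `k + t`: the cost of accessing these positions once each.
∑range : ℕ → ℕ → ℕ
∑range k zero    = 0
∑range k (suc t) = suc k + ∑range (suc k) t

Unique-shift : ∀ {z : Item l} p {q} → Unique (p ++ z ∷ q) → Unique (z ∷ p ++ q)
Unique-shift {z = z} p {q} = Unique-resp-↭ (shift z p q)

Unique-++-∷⇒fresh : ∀ {z : Item l} p {q} → Unique (p ++ z ∷ q) → All (z ≢_) (p ++ q)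
Unique-++-∷⇒fresh p p! with z∉ ∷ _ ← Unique-shift p p! = z∉

-- Here `r` holds the items already requested, latest first. MTF2 has moved each of them to the
-- front, while the schedule has moved none, so the next item is at position `length r + 1` in both
-- lists.
request-each : ∀ todo {r} {bits : Bits l} {LA LO a o} → Unique (r ++ todo) →
  AllBits false bits r → AllBits true bits todo →
  toList LA ≡ r ++ todo → toList LO ≡ r ʳ++ todo →
  (∀ {bits′ LA′} → AllBits false bits′ (todo ʳ++ r) → toList LA′ ≡ todo ʳ++ r →
   Forces bits′ LA′ LO a o) →
  Forces bits LA LO (∑range (length r) (length todo) + a)
                    (∑range (length r) (length todo) + o)
request-each [] {r} r! r0 [] LA≡ LO≡ k = k r0 (trans LA≡ (++-identityʳ r))
request-each (z ∷ todo) {r} {bits} {LA} {LO} {a} {o} r! r0 (z1 ∷ todo1) LA≡ LO≡ k =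
  subst₂ (Forces bits LA LO)
    (sym (+-assoc (suc (length r)) _ a))
    (trans (cong (λ m → suc m + (∑range (suc (length r)) (length todo) + o)) (length-reverse r))
           (sym (+-assoc (suc (length r)) _ o)))
    (request-move z∉r (All-reverse⁺ z∉r) LA≡ (trans LO≡ (ʳ++-defn r)) 0 z≤n z1
      (request-each todo (Unique-shift r r!)
        (lookup-flip bits z z1 ∷ AllBits-flip bits z∉r r0) (AllBits-flip bits z∉todo todo1)
        (moveToFront-++ LA z∉r LA≡) LO≡ k))
  where
  z∉r    = Allₚ.++⁻ˡ r (Unique-++-∷⇒fresh r r!)
  z∉todo = Allₚ.++⁻ʳ r (Unique-++-∷⇒fresh r r!)

-- Here `e` holds the finished items, latest first, at the front of both lists. The rest is reversed
-- in MTF2's list, so the next item is last there but directly behind `e` for the schedule.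
request-each-thrice : ∀ todo {e} {bits : Bits l} {LA LO a o} → Unique (e ++ todo) →
  AllBits true bits e → AllBits false bits todo →
  toList LA ≡ e ++ reverse todo → toList LO ≡ e ++ todo →
  (∀ {bits′ LA′ LO′} → AllBits true bits′ (todo ʳ++ e) →
   toList LA′ ≡ todo ʳ++ e → toList LO′ ≡ todo ʳ++ e → Forces bits′ LA′ LO′ a o) →
  Forces bits LA LO (length todo * suc (2 * (length e + length todo)) + a)
                    (∑range (length e) (length todo) + 2 * length todo + o)
request-each-thrice [] {e} e! e1 [] LA≡ LO≡ k =
  k e1 (trans LA≡ (++-identityʳ e)) (trans LO≡ (++-identityʳ e))
request-each-thrice (z ∷ todo) {e} {bits} {LA} {LO} {a} {o} e! e1 (z0 ∷ todo0) LA≡ LO≡ k =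
  subst₂ (Forces bits LA LO) algorithmCost optimalCost
    -- The bit of `z` runs through 0, 1, 0, 1. MTF2 pays for its last place twice, moving only on
    -- the second request, and then pays 1; the schedule passes `e` at once and pays 1 for each
    -- later request.
    (request-stay z∉p z∉e LA≡′ LO≡ (length e) ≤-refl z0
      (request-move z∉p [] LA≡′ LO≡′ 0 z≤n z1
        (request-stay [] [] LA≡″ LO≡′ 0 z≤n z2
          (request-each-thrice todo (Unique-shift e e!)
            (lookup-flip bits₂ z z2 ∷ flips z∉e e1) (flips z∉todo todo0)
            LA≡‴ LO≡′ k))))
  where
  z∉e    = Allₚ.++⁻ˡ e (Unique-++-∷⇒fresh e e!)
  z∉todo = Allₚ.++⁻ʳ e (Unique-++-∷⇒fresh e e!)

  p = e ++ reverse todo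

  z∉p : All (z ≢_) p
  z∉p = Allₚ.++⁺ z∉e (All-reverse⁺ z∉todo)

  LA≡′ : toList LA ≡ p ++ z ∷ []
  LA≡′ = trans LA≡ (trans (cong (e ++_) (unfold-reverse z todo)) (sym (++-assoc e _ _)))

  LA≡″ : toList (moveToFront z LA) ≡ z ∷ p ++ []
  LA≡″ = moveToFront-++ LA z∉p LA≡′

  LA≡‴ : toList (moveToFront z LA) ≡ z ∷ p
  LA≡‴ = trans LA≡″ (cong (z ∷_) (++-identityʳ p))

  LO≡′ : toList (advance (length e) z LO) ≡ z ∷ e ++ todo
  LO≡′ = advance-++ LO z∉e LO≡

  bits₁ = flipBit z bits
  bits₂ = flipBit z bits₁

  z1 = lookup-flip bits z z0
  z2 = lookup-flip bits₁ z z1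

  flips : ∀ {b ws} → All (z ≢_) ws → AllBits b bits ws →
          AllBits b (flipBit z bits₂) ws
  flips z∉ws =
    AllBits-flip bits₂ z∉ws ∘ AllBits-flip bits₁ z∉ws ∘ AllBits-flip bits z∉ws

  lemmaA : ∀ e t a → suc (e + t) + (suc (e + t) + (1 + (t * suc (2 * suc (e + t)) + a))) ≡
                     suc t * suc (2 * (e + suc t)) + a
  lemmaA = solve-∀

  algorithmCost : suc (length p) + (suc (length p) +
    (1 + (length todo * suc (2 * suc (length e + length todo)) + a))) ≡
    suc (length todo) * suc (2 * (length e + suc (length todo))) + a
  algorithmCost rewrite length-++ e {reverse todo} | length-reverse todo =
    lemmaA (length e) (length todo) a

  lemmaO : ∀ e s t o → suc e + (1 + (1 + (s + 2 * t + o))) ≡ suc e + s + 2 * suc t + o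
  lemmaO = solve-∀

  optimalCost : suc (length e) + (1 + (1 +
    (∑range (suc (length e)) (length todo) + 2 * length todo + o))) ≡
    ∑range (length e) (suc (length todo)) + 2 * suc (length todo) + o
  optimalCost = lemmaO (length e) _ (length todo) o

algorithmRound optimalRound : ℕ → ℕ
algorithmRound m = ∑range 0 m + m * suc (2 * m)
optimalRound   m = ∑range 0 m + (∑range 0 m + 2 * m)

round : ∀ {ws} {bits : Bits l} {LA LO a o} → Unique ws → AllBits true bits ws →
  toList LA ≡ ws → toList LO ≡ ws →
  (∀ {bits′ LA′ LO′} → AllBits true bits′ (reverse ws) →
   toList LA′ ≡ reverse ws → toList LO′ ≡ reverse ws → Forces bits′ LA′ LO′ a o) →
  Forces bits LA LO (algorithmRound (length ws) + a) (optimalRound (length ws) + o)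
round {ws = ws} {a = a} {o} ws! ws1 LA≡ LO≡ k =
  subst₂ (Forces _ _ _) (sym (+-assoc s _ a)) (sym (+-assoc s _ o))
    (request-each ws ws! [] ws1 LA≡ LO≡ λ ws0 LA′≡ →
      request-each-thrice ws ws! [] (All-reverse⁻ ws0) LA′≡ LO≡ k)
  where s = ∑range 0 (length ws)

-- Each round reverses the common list, so the induction ranges over all `ws`; the costs depend only
-- on its length.
rounds : ∀ N {ws} {bits : Bits l} {LA LO} → Unique ws → AllBits true bits ws →
  toList LA ≡ ws → toList LO ≡ ws →
  Forces bits LA LO (N * algorithmRound (length ws)) (N * optimalRound (length ws))
rounds zero    ws! ws1 LA≡ LO≡ = forces done z≤n z≤n
rounds (suc N) {ws} ws! ws1 LA≡ LO≡ = round ws! ws1 LA≡ LO≡ λ ws1′ LA′≡ LO′≡ →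
  subst (λ m → Forces _ _ _ (N * algorithmRound m) (N * optimalRound m)) (length-reverse ws)
    (rounds N (Unique-resp-↭ (↭-sym (↭-reverse ws)) ws!)
      ws1′ LA′≡ LO′≡)

-- A preamble that admits arbitrary initial bits: one request to an item with bit 0 sets the bit to
-- 1 and leaves both lists alone. MTF2's cost is discarded, and the schedule's is bounded
-- independently of the number of rounds.
set-bits : ∀ todo {e} {bits : Bits l} {LA LO a o} → Unique (e ++ todo) → AllBits true bits e →
  (∀ {bits′} → AllBits true bits′ (todo ʳ++ e) → Forces bits′ LA LO a o) →
  Forces bits LA LO a (∑ todo (λ z → position z LO) + o)
set-bits []         e! e1 k = k e1
set-bits (z ∷ todo) {e} {bits} {LA} {LO} {a} {o} e! e1 k with lookup bits z in b
... | true with forces S a≤ ≤o ← set-bits todo (Unique-shift e e!) (b ∷ e1) k =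
  forces S a≤ (≤-trans ≤o (+-monoˡ-≤ o (m≤n+m _ (position z LO))))
... | false with forces {σ} S a≤ ≤o ← set-bits todo {bits = flipBit z bits} (Unique-shift e e!)
       (lookup-flip bits z b ∷ AllBits-flip bits (Allₚ.++⁻ˡ e (Unique-++-∷⇒fresh e e!)) e1) k =
  forces (serve 0 z<s S)
    (≤-trans (≤-trans a≤ (m≤n+m _ (position z LA))) (≤-reflexive (sym (MTF2-stay bits LA σ b))))
    (≤-trans (+-monoʳ-≤ (position z LO) ≤o) (≤-reflexive (sym (+-assoc (position z LO) _ o))))

MTF2-lower : ∀ (bits : Bits l) {L : Arrangement l} → VecUnique L → ∀ N →
  Forces bits L L (N * algorithmRound l)
                  (∑ (toList L) (λ z → position z L) + N * optimalRound l)
MTF2-lower bits {L} L! N = set-bits (toList L) (Unique-toList L!) [] λ ws1 →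
  subst (λ m → Forces _ L L (N * algorithmRound m) (N * optimalRound m)) (length-toList L)
    (rounds N (Unique-toList L!) (All-reverse⁻ ws1) refl refl)

-- Closed forms for the costs of a round.

∑range-closed : ∀ k t → 2 * ∑range k t ≡ t * (2 * k + suc t)
∑range-closed k zero    = refl
∑range-closed k (suc t) = begin
  2 * (suc k + ∑range (suc k) t)        ≡⟨ *-distribˡ-+ 2 (suc k) _ ⟩
  2 * suc k + 2 * ∑range (suc k) t      ≡⟨ cong (λ s → 2 * suc k + s) (∑range-closed (suc k) t) ⟩
  2 * suc k + t * (2 * suc k + suc t)   ≡⟨ lemma k t ⟩
  suc t * (2 * k + suc (suc t))         ∎
  where
  open ≡-Reasoning
  lemma : ∀ k t → 2 * suc k + t * (2 * suc k + suc t) ≡ suc t * (2 * k + suc (suc t))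
  lemma = solve-∀

2*algorithmRound : ∀ m → 2 * algorithmRound m ≡ m * (5 * m + 3)
2*algorithmRound m = begin
  2 * (∑range 0 m + m * suc (2 * m))      ≡⟨ *-distribˡ-+ 2 (∑range 0 m) _ ⟩
  2 * ∑range 0 m + 2 * (m * suc (2 * m))  ≡⟨ cong (_+ 2 * (m * suc (2 * m))) (∑range-closed 0 m) ⟩
  m * suc m + 2 * (m * suc (2 * m))       ≡⟨ lemma m ⟩
  m * (5 * m + 3)                         ∎
  where
  open ≡-Reasoning
  lemma : ∀ m → m * suc m + 2 * (m * suc (2 * m)) ≡ m * (5 * m + 3)
  lemma = solve-∀

optimalRound-closed : ∀ m → optimalRound m ≡ m * (m + 3)
optimalRound-closed m = begin
  ∑range 0 m + (∑range 0 m + 2 * m)  ≡⟨ lemma (∑range 0 m) m ⟩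
  2 * ∑range 0 m + 2 * m             ≡⟨ cong (_+ 2 * m) (∑range-closed 0 m) ⟩
  m * suc m + 2 * m                  ≡⟨ lemma′ m ⟩
  m * (m + 3)                        ∎
  where
  open ≡-Reasoning
  lemma : ∀ s m → s + (s + 2 * m) ≡ 2 * s + 2 * m
  lemma = solve-∀
  lemma′ : ∀ m → m * suc m + 2 * m ≡ m * (m + 3)
  lemma′ = solve-∀

-- Naturals among the rationals, and the gap below 5/2.

toℚᵘ-fromℕ : ∀ n → toℚᵘ (fromℕ n) ℚᵘ.≃ mkℚᵘ (+ n) 0
toℚᵘ-fromℕ n = ℚₚ.toℚᵘ-fromℚᵘ (mkℚᵘ (+ n) 0)

fromℕ-+ : ∀ m n → fromℕ (m + n) ≡ fromℕ m ℚ.+ fromℕ n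
fromℕ-+ m n = ℚₚ.toℚᵘ-injective (begin
  toℚᵘ (fromℕ (m + n))                 ≈⟨ toℚᵘ-fromℕ (m + n) ⟩
  mkℚᵘ (+ (m + n)) 0                   ≈⟨ *≡* (lemma (+ m) (+ n)) ⟩
  mkℚᵘ (+ m) 0 ℚᵘ.+ mkℚᵘ (+ n) 0       ≈⟨ ℚᵘₚ.+-cong (toℚᵘ-fromℕ m) (toℚᵘ-fromℕ n) ⟨
  toℚᵘ (fromℕ m) ℚᵘ.+ toℚᵘ (fromℕ n)   ≈⟨ ℚₚ.toℚᵘ-homo-+ (fromℕ m) (fromℕ n) ⟨
  toℚᵘ (fromℕ m ℚ.+ fromℕ n)           ∎)
  where
  open ℚᵘₚ.≃-Reasoning
  lemma : ∀ p q → (p ℤ.+ q) ℤ.* (+ 1) ≡ (p ℤ.* + 1 ℤ.+ q ℤ.* + 1) ℤ.* + 1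
  lemma = solveℤ-∀

fromℕ-* : ∀ m n → fromℕ (m * n) ≡ fromℕ m ℚ.* fromℕ n
fromℕ-* m n = ℚₚ.toℚᵘ-injective (begin
  toℚᵘ (fromℕ (m * n))                 ≈⟨ toℚᵘ-fromℕ (m * n) ⟩
  mkℚᵘ (+ (m * n)) 0                   ≈⟨ *≡* (cong (ℤ._* + 1) (ℤₚ.pos-* m n)) ⟩
  mkℚᵘ (+ m) 0 ℚᵘ.* mkℚᵘ (+ n) 0       ≈⟨ ℚᵘₚ.*-cong (toℚᵘ-fromℕ m) (toℚᵘ-fromℕ n) ⟨
  toℚᵘ (fromℕ m) ℚᵘ.* toℚᵘ (fromℕ n)   ≈⟨ ℚₚ.toℚᵘ-homo-* (fromℕ m) (fromℕ n) ⟨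
  toℚᵘ (fromℕ m ℚ.* fromℕ n)           ∎)
  where open ℚᵘₚ.≃-Reasoning

fromℕ-mono-≤ : ∀ {m n} → m ≤ n → fromℕ m ℚ.≤ fromℕ n
fromℕ-mono-≤ {m} {n} m≤n = ℚₚ.toℚᵘ-cancel-≤ (begin
  toℚᵘ (fromℕ m)  ≃⟨ toℚᵘ-fromℕ m ⟩
  mkℚᵘ (+ m) 0    ≤⟨ *≤* (ℤₚ.*-monoʳ-≤-nonNeg (+ 1) (ℤ.+≤+ m≤n)) ⟩
  mkℚᵘ (+ n) 0    ≃⟨ toℚᵘ-fromℕ n ⟨
  toℚᵘ (fromℕ n)  ∎)
  where open ℚᵘₚ.≤-Reasoning

fromℕ-cancel-≤ : ∀ {m n} → fromℕ m ℚ.≤ fromℕ n → m ≤ n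
fromℕ-cancel-≤ {m} {n} m≤n with *≤* p ← ℚᵘₚ.≤-respˡ-≃ (toℚᵘ-fromℕ m)
                                          (ℚᵘₚ.≤-respʳ-≃ (toℚᵘ-fromℕ n) (ℚₚ.toℚᵘ-mono-≤ m≤n)) =
  ℤₚ.drop‿+≤+ (ℤₚ.*-cancelʳ-≤-pos (+ m) (+ n) (+ 1) p)

fromℕ-nonNeg : ∀ n → ℚ.NonNegative (fromℕ n)
fromℕ-nonNeg n = ℚ.nonNegative (fromℕ-mono-≤ (z≤n {n}))

-- Denominators are at least 1. This replaces the additive constant by a natural number.
≤-fromℕ : ∀ p → p ℚ.≤ fromℕ ℤ.∣ ↥ p ∣
≤-fromℕ p@(mkℚ n d _) = ℚₚ.toℚᵘ-cancel-≤ (begin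
  mkℚᵘ n d                      ≤⟨ *≤* (bound n) ⟩
  mkℚᵘ (+ ℤ.∣ n ∣) 0            ≃⟨ toℚᵘ-fromℕ ℤ.∣ n ∣ ⟨
  toℚᵘ (fromℕ ℤ.∣ n ∣)          ∎)
  where
  open ℚᵘₚ.≤-Reasoning
  bound : ∀ n → n ℤ.* + 1 ℤ.≤ + ℤ.∣ n ∣ ℤ.* + suc d
  bound (+ m)        = subst₂ ℤ._≤_ (ℤₚ.pos-* m 1) (ℤₚ.pos-* m (suc d))
                         (ℤ.+≤+ (*-monoʳ-≤ m (s≤s z≤n)))
  bound ℤ.-[1+ m ] = ℤ.-≤+

-- Integrality sharpens `2p < 5k` to `2p + 1 ≤ 5k`, which is then multiplied by `k`. The shape is
-- that of cross-multiplied unnormalised fractions.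
integer-gap : ∀ p k → p ℤ.* + 2 ℤ.< + 5 ℤ.* + k →
  ((+ (2 * k) ℤ.* p) ℤ.* + 1 ℤ.+ + 1 ℤ.* + k) ℤ.* + 1 ℤ.≤ + (5 * k) ℤ.* + k
integer-gap p k p< = begin
  ((+ (2 * k) ℤ.* p) ℤ.* + 1 ℤ.+ + 1 ℤ.* + k) ℤ.* + 1
    ≡⟨ cong (λ q → ((q ℤ.* p) ℤ.* + 1 ℤ.+ + 1 ℤ.* + k) ℤ.* + 1) (ℤₚ.pos-* 2 k) ⟩
  ((+ 2 ℤ.* + k ℤ.* p) ℤ.* + 1 ℤ.+ + 1 ℤ.* + k) ℤ.* + 1
    ≡⟨ lemma (+ k) p ⟩
  (+ 1 ℤ.+ p ℤ.* + 2) ℤ.* + k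
    ≤⟨ ℤₚ.*-monoʳ-≤-nonNeg (+ k) (ℤₚ.i<j⇒suc[i]≤j p<) ⟩
  + 5 ℤ.* + k ℤ.* + k
    ≡⟨ cong (ℤ._* + k) (ℤₚ.pos-* 5 k) ⟨
  + (5 * k) ℤ.* + k ∎
  where
  open ℤₚ.≤-Reasoning
  lemma : ∀ k p → ((+ 2 ℤ.* k ℤ.* p) ℤ.* + 1 ℤ.+ + 1 ℤ.* k) ℤ.* + 1 ≡
                  (+ 1 ℤ.+ p ℤ.* + 2) ℤ.* k
  lemma = solveℤ-∀

-- A fraction with denominator `k` below 5/2 is at most `5/2 - 1/2k`; the inequality is scaled by
-- `2k`.
<5/2⇒gap : ∀ {c} → c ℚ.< + 5 / 2 → let k = ↧ₙ c in
           fromℕ (2 * k) ℚ.* c ℚ.+ fromℕ 1 ℚ.≤ fromℕ (5 * k)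
<5/2⇒gap c@{mkℚ p d _} (ℚ.*<* p<) = ℚₚ.toℚᵘ-cancel-≤ (begin
  toℚᵘ (fromℕ (2 * k) ℚ.* c ℚ.+ fromℕ 1)
    ≃⟨ ℚₚ.toℚᵘ-homo-+ (fromℕ (2 * k) ℚ.* c) (fromℕ 1) ⟩
  toℚᵘ (fromℕ (2 * k) ℚ.* c) ℚᵘ.+ mkℚᵘ (+ 1) 0
    ≃⟨ ℚᵘₚ.+-congˡ (mkℚᵘ (+ 1) 0) (ℚₚ.toℚᵘ-homo-* (fromℕ (2 * k)) c) ⟩
  toℚᵘ (fromℕ (2 * k)) ℚᵘ.* mkℚᵘ p d ℚᵘ.+ mkℚᵘ (+ 1) 0
    ≃⟨ ℚᵘₚ.+-congˡ (mkℚᵘ (+ 1) 0) (ℚᵘₚ.*-congʳ (toℚᵘ-fromℕ (2 * k))) ⟩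
  mkℚᵘ (+ (2 * k)) 0 ℚᵘ.* mkℚᵘ p d ℚᵘ.+ mkℚᵘ (+ 1) 0
    ≤⟨ *≤* gap ⟩
  mkℚᵘ (+ (5 * k)) 0
    ≃⟨ toℚᵘ-fromℕ (5 * k) ⟨
  toℚᵘ (fromℕ (5 * k)) ∎)
  where
  open ℚᵘₚ.≤-Reasoning
  k = suc d

  gap : ℚᵘ.↥ (mkℚᵘ (+ (2 * k)) 0 ℚᵘ.* mkℚᵘ p d ℚᵘ.+ mkℚᵘ (+ 1) 0) ℤ.* + 1 ℤ.≤
        + (5 * k) ℤ.* ℚᵘ.↧ (mkℚᵘ (+ (2 * k)) 0 ℚᵘ.* mkℚᵘ p d ℚᵘ.+ mkℚᵘ (+ 1) 0)
  gap = subst₂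
    (λ m n → ((+ (2 * k) ℤ.* p) ℤ.* + 1 ℤ.+ + 1 ℤ.* + m) ℤ.* + 1 ℤ.≤ + (5 * k) ℤ.* + n)
    (sym (*-identityˡ k)) (sym (trans (*-identityʳ (1 * k)) (*-identityˡ k)))
    (integer-gap p k p<)

-- The competitive ratio.

OPT-attained : ∀ (L : Arrangement l) σ → ∃ λ (S : Schedule L σ) → cost S ≡ OPT L σ
OPT-attained L σ = proj₁ (proj₂ (minimumCost L σ))

OPT≤cost : ∀ {L : Arrangement l} {σ} (S : Schedule L σ) → OPT L σ ≤ cost S
OPT≤cost {L = L} {σ} = proj₂ (proj₂ (minimumCost L σ))

5/2-competitive : (init : InitialBits) → Competitive init (+ 5 / 2)
5/2-competitive init l = fromℕ B , bound
  where
  B = l * (l * 5)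

  bound : ∀ L → VecUnique L → ∀ σ →
          fromℕ (MTF2-cost (init L) L σ) ℚ.≤ (+ 5 / 2) ℚ.* fromℕ (OPT L σ) ℚ.+ fromℕ B
  bound L L! σ with S , S≡ ← OPT-attained L σ = ℚₚ.*-cancelˡ-≤-pos (fromℕ 4) (begin
    fromℕ 4 ℚ.* fromℕ A
      ≡⟨ fromℕ-* 4 A ⟨
    fromℕ (4 * A)
      -- Weakening `B` to `4 * B` keeps the additive constant a natural number after division by 4.
      ≤⟨ fromℕ-mono-≤ (≤-trans (subst (λ m → 4 * A ≤ 10 * m + B) S≡ (MTF2-upper (init L) L! S))
                               (+-monoʳ-≤ (10 * O) (m≤n*m B 4))) ⟩
    fromℕ (10 * O + 4 * B)
      ≡⟨ fromℕ-+ (10 * O) (4 * B) ⟩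
    fromℕ (10 * O) ℚ.+ fromℕ (4 * B)
      -- `fromℕ 10` and `fromℕ 4 ℚ.* (+ 5 / 2)` agree by computation.
      ≡⟨ cong₂ ℚ._+_ (fromℕ-* 10 O) (fromℕ-* 4 B) ⟩
    fromℕ 4 ℚ.* (+ 5 / 2) ℚ.* fromℕ O ℚ.+ fromℕ 4 ℚ.* fromℕ B
      ≡⟨ cong (ℚ._+ _) (ℚₚ.*-assoc (fromℕ 4) (+ 5 / 2) (fromℕ O)) ⟩
    fromℕ 4 ℚ.* ((+ 5 / 2) ℚ.* fromℕ O) ℚ.+ fromℕ 4 ℚ.* fromℕ B
      ≡⟨ ℚₚ.*-distribˡ-+ (fromℕ 4) ((+ 5 / 2) ℚ.* fromℕ O) (fromℕ B) ⟨
    fromℕ 4 ℚ.* ((+ 5 / 2) ℚ.* fromℕ O ℚ.+ fromℕ B) ∎)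
    where
    open ℚₚ.≤-Reasoning
    A = MTF2-cost (init L) L σ
    O = OPT L σ

-- Scale by `2k` and use `2k c + 1 ≤ 5k`. Keeping the gained `O` on the left avoids subtraction.
clear-denominators : ∀ c b k → fromℕ (2 * k) ℚ.* c ℚ.+ fromℕ 1 ℚ.≤ fromℕ (5 * k) →
  ∀ A O → fromℕ A ℚ.≤ c ℚ.* fromℕ O ℚ.+ b →
  2 * k * A + O ≤ 5 * k * O + 2 * k * ℤ.∣ ↥ b ∣
clear-denominators c b k gap A O A≤ = fromℕ-cancel-≤ (begin
  fromℕ (2 * k * A + O)
    ≡⟨ trans (fromℕ-+ (2 * k * A) O) (cong (ℚ._+ fO) (fromℕ-* (2 * k) A)) ⟩
  2k ℚ.* fromℕ A ℚ.+ fO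
    ≤⟨ ℚₚ.+-monoˡ-≤ fO (ℚₚ.*-monoˡ-≤-nonNeg 2k ⦃ fromℕ-nonNeg (2 * k) ⦄
         (ℚₚ.≤-trans A≤ (ℚₚ.+-monoʳ-≤ (c ℚ.* fO) (≤-fromℕ b)))) ⟩
  2k ℚ.* (c ℚ.* fO ℚ.+ fB) ℚ.+ fO
    ≡⟨ cong (ℚ._+ fO) (ℚₚ.*-distribˡ-+ 2k (c ℚ.* fO) fB) ⟩
  2k ℚ.* (c ℚ.* fO) ℚ.+ 2k ℚ.* fB ℚ.+ fO
    ≡⟨ ℚₚ.+-assoc (2k ℚ.* (c ℚ.* fO)) (2k ℚ.* fB) fO ⟩
  2k ℚ.* (c ℚ.* fO) ℚ.+ (2k ℚ.* fB ℚ.+ fO)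
    ≡⟨ cong₂ ℚ._+_ (sym (ℚₚ.*-assoc 2k c fO)) (ℚₚ.+-comm (2k ℚ.* fB) fO) ⟩
  2k ℚ.* c ℚ.* fO ℚ.+ (fO ℚ.+ 2k ℚ.* fB)
    ≡⟨ ℚₚ.+-assoc (2k ℚ.* c ℚ.* fO) fO (2k ℚ.* fB) ⟨
  2k ℚ.* c ℚ.* fO ℚ.+ fO ℚ.+ 2k ℚ.* fB
    ≡⟨ cong (λ q → 2k ℚ.* c ℚ.* fO ℚ.+ q ℚ.+ 2k ℚ.* fB) (ℚₚ.*-identityˡ fO) ⟨
  2k ℚ.* c ℚ.* fO ℚ.+ fromℕ 1 ℚ.* fO ℚ.+ 2k ℚ.* fB
    ≡⟨ cong (ℚ._+ 2k ℚ.* fB) (ℚₚ.*-distribʳ-+ fO (2k ℚ.* c) (fromℕ 1)) ⟨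
  (2k ℚ.* c ℚ.+ fromℕ 1) ℚ.* fO ℚ.+ 2k ℚ.* fB
    ≤⟨ ℚₚ.+-monoˡ-≤ (2k ℚ.* fB) (ℚₚ.*-monoʳ-≤-nonNeg fO ⦃ fromℕ-nonNeg O ⦄ gap) ⟩
  fromℕ (5 * k) ℚ.* fO ℚ.+ 2k ℚ.* fB
    ≡⟨ cong₂ ℚ._+_ (fromℕ-* (5 * k) O) (fromℕ-* (2 * k) B) ⟨
  fromℕ (5 * k * O) ℚ.+ fromℕ (2 * k * B)
    ≡⟨ fromℕ-+ (5 * k * O) (2 * k * B) ⟨
  fromℕ (5 * k * O + 2 * k * B) ∎)
  where
  open ℚₚ.≤-Reasoning
  B  = ℤ.∣ ↥ b ∣
  2k = fromℕ (2 * k)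
  fO = fromℕ O
  fB = fromℕ B

-- With m = 12k the additive term 3 in the optimal cost m (m + 3) of a round
-- outweighs what the factor 5/2 - 1/2k concedes.
rounds-exceed : ∀ k .⦃ _ : NonZero k ⦄ {A O} P B →
  let m = 12 * k; N = suc (5 * k * P + 2 * k * B) in
  N * algorithmRound m ≤ A → O ≤ P + N * optimalRound m →
  ¬ 2 * k * A + O ≤ 5 * k * O + 2 * k * B
rounds-exceed k {A} {O} P B A≥ O≤ A≤ = <⇒≱ excess (begin
  k * N * (m * (5 * m + 3)) + O′
    ≡⟨ cong (_+ O′) (trans (cong (k * N *_) (sym (2*algorithmRound m)))
                           (lemma₁ k N (algorithmRound m))) ⟩
  2 * k * (N * algorithmRound m) + O′
    ≤⟨ +-monoˡ-≤ O′ (*-monoʳ-≤ (2 * k) A≥) ⟩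
  2 * k * A + O′
    ≡⟨ cong (λ o → 2 * k * A + o) (m+[n∸m]≡n O≤) ⟨
  2 * k * A + (O + (O′ ∸ O))
    ≡⟨ +-assoc (2 * k * A) O _ ⟨
  2 * k * A + O + (O′ ∸ O)
    -- Raising `O` to its bound `O′` preserves the assumed inequality, since the right side grows
    -- `5k` times as fast as the left.
    ≤⟨ +-mono-≤ A≤ (m≤n*m (O′ ∸ O) (5 * k) ⦃ m*n≢0 5 k ⦄) ⟩
  5 * k * O + 2 * k * B + 5 * k * (O′ ∸ O)
    ≡⟨ lemma₂ (5 * k) O (2 * k * B) (O′ ∸ O) ⟩
  5 * k * (O + (O′ ∸ O)) + 2 * k * B
    ≡⟨ cong (λ o → 5 * k * o + 2 * k * B) (m+[n∸m]≡n O≤) ⟩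
  5 * k * O′ + 2 * k * B ∎)
  where
  open ≤-Reasoning
  m  = 12 * k
  N  = suc (5 * k * P + 2 * k * B)
  O′ = P + N * optimalRound m

  lemma₁ : ∀ k N a → k * N * (2 * a) ≡ 2 * k * (N * a)
  lemma₁ = solve-∀
  lemma₂ : ∀ c o b d → c * o + b + c * d ≡ c * (o + d) + b
  lemma₂ = solve-∀
  lemma₃ : ∀ k N P B → 5 * k * (P + N * (12 * k * (12 * k + 3))) + 2 * k * B + 36 * k * N ≡
    k * N * (12 * k * (5 * (12 * k) + 3)) + N * (12 * k * (12 * k + 3)) +
    (5 * k * P + 2 * k * B)
  lemma₃ = solve-∀

  excess : 5 * k * O′ + 2 * k * B < k * N * (m * (5 * m + 3)) + O′
  -- The surplus of a round is `k m (5m + 3) + m (m + 3) - 5k m (m + 3) = m (m + 3 -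
  -- 12k)`, which is `36k` at `m = 12k`. It is added on both sides in place of a subtraction, and
  -- `N` was chosen one above `5kP + 2kB`.
  excess = +-cancelʳ-< (36 * k * N) _ _ (begin-strict
    5 * k * O′ + 2 * k * B + 36 * k * N
      ≡⟨ cong (λ o → 5 * k * (P + N * o) + 2 * k * B + 36 * k * N) (optimalRound-closed m) ⟩
    5 * k * (P + N * (m * (m + 3))) + 2 * k * B + 36 * k * N
      ≡⟨ lemma₃ k N P B ⟩
    k * N * (m * (5 * m + 3)) + N * (m * (m + 3)) + (5 * k * P + 2 * k * B)
      <⟨ +-monoʳ-< (k * N * (m * (5 * m + 3)) + N * (m * (m + 3)))
           (m≤n*m N (36 * k) ⦃ m*n≢0 36 k ⦄) ⟩
    k * N * (m * (5 * m + 3)) + N * (m * (m + 3)) + 36 * k * N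
      ≤⟨ +-monoˡ-≤ (36 * k * N) (+-monoʳ-≤ (k * N * (m * (5 * m + 3))) (m≤n+m _ P)) ⟩
    k * N * (m * (5 * m + 3)) + (P + N * (m * (m + 3))) + 36 * k * N
      ≡⟨ cong (λ o → k * N * (m * (5 * m + 3)) + (P + N * o) + 36 * k * N)
           (optimalRound-closed m) ⟨
    k * N * (m * (5 * m + 3)) + O′ + 36 * k * N ∎)

-- The order of choices matters: the denominator of `c` fixes the list length, the length fixes `b`,
-- and only then is the number of rounds chosen to outweigh `b` and the preamble.
competitive⇒5/2≤ : (init : InitialBits) → ∀ c → Competitive init c → + 5 / 2 ℚ.≤ c
competitive⇒5/2≤ init c@(mkℚ _ _ _) competitive = ℚₚ.≮⇒≥ λ c< →
  refute c< (MTF2-lower (init L) L! N)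
  where
  k  = ↧ₙ c
  m  = 12 * k
  L  = Vec.allFin m
  b  = proj₁ (competitive m)
  P  = ∑ (toList L) (λ z → position z L)
  N  = suc (5 * k * P + 2 * k * ℤ.∣ ↥ b ∣)

  L! : VecUnique L
  L! = tabulate⁺ id

  refute : c ℚ.< + 5 / 2 →
           ¬ Forces (init L) L L (N * algorithmRound m) (P + N * optimalRound m)
  refute c< (forces {σ} S A≥ ≤O) =
    rounds-exceed k P ℤ.∣ ↥ b ∣ A≥ (≤-trans (OPT≤cost S) ≤O)
      (clear-denominators c b k (<5/2⇒gap c<) (MTF2-cost (init L) L σ) (OPT L σ)
        (proj₂ (competitive m) L L! σ))

theorem7 : (init : InitialBits) → CompetitiveRatio init (+ 5 / 2)
-- The infimum is attained, so a lower bound need only be applied to 5/2 itself.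
theorem7 init = competitive⇒5/2≤ init , λ _ lower → lower (+ 5 / 2) (5/2-competitive init)
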